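{- Let $\bigcirc$ be a modality on a universe $\mathcal U$ and let $A$ be a type in $\mathcal U$. The induced functor $\bigcirc^A:A/\mathcal U\to(A/\mathcal U)_{\bigcirc}$, viewed as left adjoint to the forgetful functor $\mathcal F_{\bigcirc,A}:(A/\mathcal U)_{\bigcirc}\to A/\mathcal U$ with the adjunction data of the context, is $2$-coherent.
   Context: Everything is inside Book HoTT; $p\cdot q$ is path concatenation, $\mathsf{ap}_f$ the action of $f$ on paths. Wild category: objects, hom types (not assumed sets), identities, composition $\circ$, unit laws (paths), $\mathsf{assoc}(f,g,h):(f\circ g)\circ h=f\circ(g\circ h)$; no further coherence. Wild functor $L$: functions on objects and morphisms with paths $L_\circ(g,f):L(g)\circ L(f)=L(g\circ f)$ and $L_{\mathsf{id}}$. Wild adjunction $L\dashv R$ ($L:\mathcal C\to\mathcal D$): equivalences $\psi:\mathsf{hom}_{\mathcal D}(L(B),X)\simeq\mathsf{hom}_{\mathcal C}(B,R(X))$ with paths $\mathsf{nat}_{cod}(g,h):R(g)\circ\psi(h)=\psi(g\circ h)$ and $\mathsf{nat}_{dom}(f,h):\psi(h)\circ f=\psi(h\circ L(f))$. $L$ is $2$-coherent if for all $h_1:\mathsf{hom}_{\mathcal D}(L(X),Y)$, $h_2:\mathsf{hom}_{\mathcal C}(Z,X)$, $h_3:\mathsf{hom}_{\mathcal C}(W,Z)$: $$\mathsf{assoc}(\psi(h_1),h_2,h_3)\cdot\mathsf{nat}_{dom}(h_2\circ h_3,h_1)\cdot\mathsf{ap}_\psi(\mathsf{ap}_{h_1\circ-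 }(L_\circ(h_2,h_3)))^{ -1}$$ $$=\ \mathsf{ap}_{ -\circ h_3}(\mathsf{nat}_{dom}(h_2,h_1))\cdot\mathsf{nat}_{dom}(h_3,h_1\circ L(h_2))\cdot\mathsf{ap}_\psi(\mathsf{assoc}(h_1,L(h_2),L(h_3))).$$ Modality: functions $\bigcirc:\mathcal U\to\mathcal U$ and $\eta:\prod_{X:\mathcal U}X\to\bigcirc X$, where $X$ is called modal if $\eta_X$ is an equivalence and $\mathcal U_{\bigcirc}$ is the subuniverse of modal types, such that: (i) each $\bigcirc X$ is modal; (ii) for all $X$ and $x,y:\bigcirc X$ the type $x=y$ is modal; (iii) ($\bigcirc$-induction) for all $X$ and $P:\bigcirc X\to\mathcal U_{\bigcirc}$ the map $-\circ\eta_X:(\prod_{x:\bigcirc X}P(x))\to\prod_{x:X}P(\eta_X(x))$ has a section. $A/\mathcal U$ is the wild category with objects pairs $(X,s)$, $X:\mathcal U$, $s:A\to X$; morphisms $(X,s)\to_A(Y,t)$ are pairs $(k,p)$ with $k:X\to Y$ and $p:k\circ s\sim t$; composition is $(g,q)\circ(f,p)=(g\circ f,\ \lambda a.\,\mathsf{ap}_g(p(a))\cdot q(a))$, with evident unit and associativity laws. A path $(k,p)=(k',p')$ amounts to a homotopy $H:k\sim k'$ with $H(s(a))^{ -1}\cdot p(a)=p'(a)$ for all $a:A$. $(A/\mathcal U)_{\bigcirc}$ is the full wild subcategory on those $(X,s)$ with $X$ modal, and $\mathcal F_{\bigcirc,A}$ is the inclusion. The functor $\bigcirc^A$: on objects $(X,s)\mapsto(\bigcirc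 X,\eta_X\circ s)$. For $f:X\to Y$, $\bigcirc f:\bigcirc X\to\bigcirc Y$ is obtained by $\bigcirc$-recursion from $\eta_Y\circ f$, with computation path $\beta_f(x):\bigcirc f(\eta_X(x))=\eta_Y(f(x))$; on morphisms $\bigcirc^A(f,p):=(\bigcirc f,\ \lambda a.\,\beta_f(s(a))\cdot\mathsf{ap}_{\eta_Y}(p(a)))$. The composition law $\bigcirc^A(g,q)\circ\bigcirc^A(f,p)=\bigcirc^A((g,q)\circ(f,p))$ has underlying homotopy defined by $\bigcirc$-induction from $x\mapsto\mathsf{ap}_{\bigcirc g}(\beta_f(x))\cdot\beta_g(f(x))\cdot\beta_{g\circ f}(x)^{ -1}$, together with the evident compatibility over $A$ (from the computation rule of $\bigcirc$-induction and naturality of $\beta_g$). The adjunction: for an $A$-type $U$ and a modal $A$-type $V$, $\psi:(\bigcirc^AU\to_AV)\simeq(U\to_AV)$ is $(h,h_0)\mapsto(h\circ\eta,h_0)$ (precomposition with the unit). $\mathsf{nat}_{cod}$ is trivial. For $(f,p):U\to_AU'$ and $(h,h_0):\bigcirc^AU'\to_AV$, $\mathsf{nat}_{dom}$ is the path $\psi(h,h_0)\circ(f,p)=\psi((h,h_0)\circ\bigcirc^A(f,p))$ with underlying homotopy $x\mapsto\mathsf{ap}_h(\beta_f(x))^{ -1}$ and the evident compatibility over $A$. -}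

{-# OPTIONS --without-K #-}

module Defs where

open import Level using (Level; _⊔_; suc)
open import Data.Product.Base using (Σ; Σ-syntax; _×_; _,_; proj₁; proj₂)
open import Function.Base using (id; _∘′_)
open import Relation.Binary.PropositionalEquality
  using (_≡_; refl; sym; trans; cong; cong-app)
open import Relation.Binary.PropositionalEquality.Properties
  using (trans-symˡ)

-- Concatenation p · q is trans p q and ap is cong.  Without K, identity types
-- may carry higher structure, so equations between paths have content.

HasSection : ∀ {a b} {X : Set a} {Y : Set b} → (X → Y) → Set (a ⊔ b)
HasSection {X = X} {Y} f = Σ[ g ∈ (Y → X) ] (∀ y → f (g y) ≡ y)

HasRetraction : ∀ {a b} {X : Set a} {Y : Set b} → (X → Y) → Set (a ⊔ b)
HasRetraction {X = X} {Y} f = Σ[ h ∈ (Y → X) ] (∀ x → h (f x) ≡ x)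

-- Bi-invertible maps, so that being an equivalence is a proposition.
IsEquiv : ∀ {a b} {X : Set a} {Y : Set b} → (X → Y) → Set (a ⊔ b)
IsEquiv f = HasSection f × HasRetraction f

-- The extensionality axiom of Book HoTT: happly (here cong-app) is an
-- equivalence.
FunExt : ∀ a b → Set (suc (a ⊔ b))
FunExt a b = {X : Set a} {Y : X → Set b} (f g : ∀ x → Y x) →
             IsEquiv (cong-app {f = f} {g = g})

record WildCat (o h : Level) : Set (suc (o ⊔ h)) where
  infixr 9 _∘_
  field
    Obj   : Set o
    Hom   : Obj → Obj → Set h
    idn   : ∀ {X} → Hom X X
    _∘_   : ∀ {X Y Z} → Hom Y Z → Hom X Y → Hom X Z
    unitˡ : ∀ {X Y} (f : Hom X Y) → idn ∘ f ≡ f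
    unitʳ : ∀ {X Y} (f : Hom X Y) → f ∘ idn ≡ f
    assoc : ∀ {W X Y Z} (f : Hom Y Z) (g : Hom X Y) (h : Hom W X) →
            (f ∘ g) ∘ h ≡ f ∘ (g ∘ h)

record WildFunctor {o₁ h₁ o₂ h₂} (C : WildCat o₁ h₁) (D : WildCat o₂ h₂) :
                   Set (o₁ ⊔ h₁ ⊔ o₂ ⊔ h₂) where
  private
    module C = WildCat C
    module D = WildCat D
  field
    obj   : C.Obj → D.Obj
    arr   : ∀ {X Y} → C.Hom X Y → D.Hom (obj X) (obj Y)
    arr-∘ : ∀ {X Y Z} (g : C.Hom Y Z) (f : C.Hom X Y) →
            arr g D.∘ arr f ≡ arr (g C.∘ f)
    arr-id : ∀ X → arr (C.idn {X}) ≡ D.idn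

record WildAdjunction {o₁ h₁ o₂ h₂} {C : WildCat o₁ h₁} {D : WildCat o₂ h₂}
                      (L : WildFunctor C D) (R : WildFunctor D C) :
                      Set (o₁ ⊔ h₁ ⊔ o₂ ⊔ h₂) where
  private
    module C = WildCat C
    module D = WildCat D
    module L = WildFunctor L
    module R = WildFunctor R
  field
    ψ         : ∀ {B X} → D.Hom (L.obj B) X → C.Hom B (R.obj X)
    ψ-isEquiv : ∀ {B X} → IsEquiv (ψ {B} {X})
    nat-cod   : ∀ {B X Y} (g : D.Hom X Y) (h : D.Hom (L.obj B) X) →
                R.arr g C.∘ ψ h ≡ ψ (g D.∘ h)
    nat-dom   : ∀ {A B X} (f : C.Hom A B) (h : D.Hom (L.obj B) X) →
                ψ h C.∘ f ≡ ψ (h D.∘ L.arr f)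

module _ {o₁ h₁ o₂ h₂} {C : WildCat o₁ h₁} {D : WildCat o₂ h₂}
         {L : WildFunctor C D} {R : WildFunctor D C}
         (adj : WildAdjunction L R) where
  private
    module C = WildCat C
    module D = WildCat D
    module L = WildFunctor L
  open WildAdjunction adj

  TwoCoherent : Set (o₁ ⊔ h₁ ⊔ o₂ ⊔ h₂)
  TwoCoherent =
    ∀ {X Z W : C.Obj} {Y : D.Obj}
    (h₁ : D.Hom (L.obj X) Y) (h₂ : C.Hom Z X) (h₃ : C.Hom W Z) →
    trans (trans (C.assoc (ψ h₁) h₂ h₃) (nat-dom (h₂ C.∘ h₃) h₁))
          (sym (cong ψ (cong (λ k → h₁ D.∘ k) (L.arr-∘ h₂ h₃))))
    ≡
    trans (trans (cong (λ k → k C.∘ h₃) (nat-dom h₂ h₁))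
                 (nat-dom h₃ (h₁ D.∘ L.arr h₂)))
          (cong ψ (D.assoc h₁ (L.arr h₂) (L.arr h₃)))

module _ {o h p} (C : WildCat o h) (P : WildCat.Obj C → Set p) where
  private module C = WildCat C

  FullSubcat : WildCat (o ⊔ p) h
  FullSubcat = record
    { Obj   = Σ C.Obj P
    ; Hom   = λ X Y → C.Hom (proj₁ X) (proj₁ Y)
    ; idn   = C.idn
    ; _∘_   = C._∘_
    ; unitˡ = C.unitˡ
    ; unitʳ = C.unitʳ
    ; assoc = C.assoc
    }

  Inclusion : WildFunctor FullSubcat C
  Inclusion = record
    { obj    = proj₁
    ; arr    = id
    ; arr-∘  = λ _ _ → refl
    ; arr-id = λ _ → refl
    }

record Modality (ℓ : Level) : Set (suc ℓ) where
  field
    ○ : Set ℓ → Set ℓ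
    η : {X : Set ℓ} → X → ○ X

  IsModal : Set ℓ → Set ℓ
  IsModal X = IsEquiv (η {X})

  𝒰○ : Set (suc ℓ)
  𝒰○ = Σ (Set ℓ) IsModal

  field
    ○-modal : ∀ X → IsModal (○ X)
    ≡-modal : ∀ {X} (x y : ○ X) → IsModal (x ≡ y)
    ○-induction : ∀ {X} (P : ○ X → 𝒰○) →
      HasSection (λ (f : ∀ z → proj₁ (P z)) (x : X) → f (η x))

  ○-elim : ∀ {X} (P : ○ X → 𝒰○) →
           (∀ x → proj₁ (P (η x))) → ∀ z → proj₁ (P z)
  ○-elim P = proj₁ (○-induction P)

  ○-elim-β : ∀ {X} (P : ○ X → 𝒰○) (d : ∀ x → proj₁ (P (η x))) →
             ∀ x → ○-elim P d (η x) ≡ d x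
  ○-elim-β P d = cong-app (proj₂ (○-induction P) d)

  ○-rec : ∀ {X Y} → IsModal Y → (X → Y) → ○ X → Y
  ○-rec {Y = Y} m = ○-elim (λ _ → Y , m)

  ○-rec-β : ∀ {X Y} (m : IsModal Y) (f : X → Y) →
            ∀ x → ○-rec m f (η x) ≡ f x
  ○-rec-β {Y = Y} m = ○-elim-β (λ _ → Y , m)

  ○-map : ∀ {X Y} → (X → Y) → ○ X → ○ Y
  ○-map {Y = Y} f = ○-rec (○-modal Y) (η ∘′ f)

  β : ∀ {X Y} (f : X → Y) (x : X) → ○-map f (η x) ≡ η (f x)
  β {Y = Y} f = ○-rec-β (○-modal Y) (η ∘′ f)

  ○-htpy : ∀ {X Y} {u v : ○ X → ○ Y} →
           (∀ x → u (η x) ≡ v (η x)) → ∀ z → u z ≡ v z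
  ○-htpy {u = u} {v} = ○-elim (λ z → (u z ≡ v z) , ≡-modal (u z) (v z))

  ○-htpy-β : ∀ {X Y} {u v : ○ X → ○ Y} (d : ∀ x → u (η x) ≡ v (η x)) →
             ∀ x → ○-htpy {u = u} {v} d (η x) ≡ d x
  ○-htpy-β {u = u} {v} =
    ○-elim-β (λ z → (u z ≡ v z) , ≡-modal (u z) (v z))

module Coslice {ℓ} (fe : FunExt ℓ ℓ) (A : Set ℓ) where

  Ob : Set (suc ℓ)
  Ob = Σ[ X ∈ Set ℓ ] (A → X)

  infix 4 _→A_
  _→A_ : Ob → Ob → Set ℓ
  (X , s) →A (Y , t) = Σ[ k ∈ (X → Y) ] (∀ a → k (s a) ≡ t a)

  idA : ∀ {X} → X →A X
  idA = id , λ _ → refl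

  comp : ∀ {X Y Z} → Y →A Z → X →A Y → X →A Z
  comp (g , q) (f , p) = (λ x → g (f x)) , λ a → trans (cong g (p a)) (q a)

  ext : {X : Set ℓ} {Y : X → Set ℓ} {f g : ∀ x → Y x} →
        (∀ x → f x ≡ g x) → f ≡ g
  ext {f = f} {g} = proj₁ (proj₁ (fe f g))

  happly-ext : {X : Set ℓ} {Y : X → Set ℓ} {f g : ∀ x → Y x}
               (H : ∀ x → f x ≡ g x) → cong-app (ext H) ≡ H
  happly-ext {f = f} {g} = proj₂ (proj₁ (fe f g))

  hom-path′ : ∀ {X Y} {f g : X →A Y} (e : proj₁ f ≡ proj₁ g) →
    (∀ a → trans (sym (cong-app e (proj₂ X a))) (proj₂ f a) ≡ proj₂ g a) →
    f ≡ g
  hom-path′ {f = k , _} refl C = cong (k ,_) (ext C)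

  -- Paths in X →A Y amount to such pairs (H , C); this is the direction from
  -- pairs to paths, by function extensionality in X and in A.
  hom-path : ∀ {X Y} {f g : X →A Y} (H : ∀ x → proj₁ f x ≡ proj₁ g x) →
    (∀ a → trans (sym (H (proj₂ X a))) (proj₂ f a) ≡ proj₂ g a) →
    f ≡ g
  hom-path {X} {f = f} H C = hom-path′ (ext H)
    (λ a → trans (cong (λ E → trans (sym (E (proj₂ X a))) (proj₂ f a))
                       (happly-ext H))
                 (C a))

  -- Here and below the compatibilities over A are defined by path induction
  -- on paths with a free endpoint, so the choice of such a definition is
  -- immaterial.
  assoc-compat : {X Y Z : Set ℓ} (f : Y → Z) (g : X → Y)
    {x x′ : X} {y : Y} {z : Z} (r : x ≡ x′) (q : g x′ ≡ y) (p : f y ≡ z) →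
    trans (cong (λ w → f (g w)) r) (trans (cong f q) p) ≡
    trans (cong f (trans (cong g r) q)) p
  assoc-compat f g refl q p = refl

  Cat : WildCat (suc ℓ) ℓ
  Cat = record
    { Obj   = Ob
    ; Hom   = _→A_
    ; idn   = λ {X} → idA {X}
    ; _∘_   = λ {X} {Y} {Z} → comp {X} {Y} {Z}
    ; unitˡ = λ {X} {Y} f → hom-path {X} {Y} (λ _ → refl)
                (λ a → unitˡ-compat (proj₂ f a))
    ; unitʳ = λ {X} {Y} f → hom-path {X} {Y} (λ _ → refl) (λ _ → refl)
    ; assoc = λ {W} {X} {Y} {Z} f g h → hom-path {W} {Z} (λ _ → refl)
                (λ a → assoc-compat (proj₁ f) (proj₁ g)
                         (proj₂ h a) (proj₂ g a) (proj₂ f a))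
    }
    where
    unitˡ-compat : {Y : Set ℓ} {y y′ : Y} (p : y ≡ y′) →
                   trans (cong id p) refl ≡ p
    unitˡ-compat refl = refl

module ModalCoslice {ℓ} (fe : FunExt ℓ ℓ) (M : Modality ℓ) (A : Set ℓ) where
  open Modality M
  open Coslice fe A

  Cat○ : WildCat (suc ℓ) ℓ
  Cat○ = FullSubcat Cat (λ X → IsModal (proj₁ X))

  𝓕 : WildFunctor Cat○ Cat
  𝓕 = Inclusion Cat (λ X → IsModal (proj₁ X))

  ○A-ob : Ob → WildCat.Obj Cat○
  ○A-ob (X , s) = (○ X , λ a → η (s a)) , ○-modal X

  ○A-arr : ∀ {X Y} → X →A Y → proj₁ (○A-ob X) →A proj₁ (○A-ob Y)
  ○A-arr {X , s} (f , p) =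
    ○-map f , λ a → trans (β f (s a)) (cong η (p a))

  ○A-∘-htpy : {X Y Z : Set ℓ} (g : Y → Z) (f : X → Y) →
              ∀ z → ○-map g (○-map f z) ≡ ○-map (λ x → g (f x)) z
  ○A-∘-htpy g f = ○-htpy (λ x →
    trans (trans (cong (○-map g) (β f x)) (β g (f x)))
          (sym (β (λ x → g (f x)) x)))

  -- Instantiated with u = ○f (η (s a)), v = ○(g ∘ f) (η (s a)), bf = β_f,
  -- bgf = β_{g ∘ f}, K the value at η (s a) of the homotopy for ○_∘, and ρ
  -- the computation rule of ○-induction.  Induction on p uses naturality
  -- of β_g.
  ○A-∘-compat : {Y Z : Set ℓ} (g : Y → Z)
    {u : ○ Y} {v : ○ Z} {y y′ : Y} {z : Z}
    (bf : u ≡ η y) (bgf : v ≡ η (g y))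
    (p : y ≡ y′) (q : g y′ ≡ z) {K : ○-map g u ≡ v} →
    (ρ : K ≡ trans (trans (cong (○-map g) bf) (β g y)) (sym bgf)) →
    trans (sym K)
          (trans (cong (○-map g) (trans bf (cong η p)))
                 (trans (β g y′) (cong η q)))
    ≡ trans bgf (cong η (trans (cong g p) q))
  ○A-∘-compat g {y = y} refl refl refl refl refl =
    trans-symˡ (trans (β g y) refl)

  ○A : WildFunctor Cat Cat○
  ○A = record
    { obj    = ○A-ob
    ; arr    = λ {X} {Y} → ○A-arr {X} {Y}
    ; arr-∘  = λ {X} {Y} {Z} g f → hom-path
        {proj₁ (○A-ob X)} {proj₁ (○A-ob Z)}
        (○A-∘-htpy (proj₁ g) (proj₁ f))
        (λ a → ○A-∘-compat (proj₁ g)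
                 (β (proj₁ f) (proj₂ X a))
                 (β (λ x → proj₁ g (proj₁ f x)) (proj₂ X a))
                 (proj₂ f a) (proj₂ g a)
                 (○-htpy-β _ (proj₂ X a)))
    ; arr-id = λ X → hom-path {proj₁ (○A-ob X)} {proj₁ (○A-ob X)}
        (○-htpy (β id))
        (λ a → id-compat (β id (proj₂ X a)) (○-htpy-β (β id) (proj₂ X a)))
    }
    where
    id-compat : {X : Set ℓ} {x y : X} (b : x ≡ y) {K : x ≡ y} → K ≡ b →
                trans (sym K) (trans b refl) ≡ refl
    id-compat refl refl = refl

  ψ : ∀ {U V} → proj₁ (○A-ob U) →A V → U →A V
  ψ (h , h₀) = (λ x → h (η x)) , h₀

  -- Instantiated with b = β_f (s a).
  nat-dom-compat : {Y V : Set ℓ} (h : ○ Y → V)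
    {u : ○ Y} {y y′ : Y} {v : V}
    (b : u ≡ η y) (p : y ≡ y′) (h₀ : h (η y′) ≡ v) →
    trans (sym (sym (cong h b))) (trans (cong (λ x → h (η x)) p) h₀) ≡
    trans (cong h (trans b (cong η p))) h₀
  nat-dom-compat h refl refl h₀ = refl

  ψ-nat-dom : ∀ {U U′ V} (f : U →A U′) (h : proj₁ (○A-ob U′) →A V) →
    comp {U} {U′} {V} (ψ {U′} {V} h) f ≡
    ψ {U} {V} (comp {proj₁ (○A-ob U)} {proj₁ (○A-ob U′)} {V}
                 h (○A-arr {U} {U′} f))
  ψ-nat-dom {U} {U′} {V} (f , p) (h , h₀) = hom-path {U} {V}
    (λ x → sym (cong h (β f x)))
    (λ a → nat-dom-compat h (β f (proj₂ U a)) (p a) (h₀ a))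

  ψ-equiv : ∀ {U V} → IsModal (proj₁ V) → IsEquiv (ψ {U} {V})
  ψ-equiv {X , s} {V , t} m = (ψ⁻¹ , ψψ⁻¹) , (ψ⁻¹ , ψ⁻¹ψ)
    where
    ψ⁻¹ : (X , s) →A (V , t) → proj₁ (○A-ob (X , s)) →A (V , t)
    ψ⁻¹ (k , k₀) = ○-rec m k , λ a → trans (○-rec-β m k (s a)) (k₀ a)

    cancel : {Y : Set ℓ} {x y z : Y} (b : x ≡ y) (c : y ≡ z) →
             trans (sym b) (trans b c) ≡ c
    cancel refl c = refl

    ψψ⁻¹ : ∀ k → ψ {X , s} {V , t} (ψ⁻¹ k) ≡ k
    ψψ⁻¹ (k , k₀) = hom-path {X , s} {V , t} (○-rec-β m k)
      (λ a → cancel (○-rec-β m k (s a)) (k₀ a))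

    r : ○ V → V
    r = proj₁ (proj₂ m)

    ε : ∀ v → r (η v) ≡ v
    ε = proj₂ (proj₂ m)

    conj : {v w : V} → η v ≡ η w → v ≡ w
    conj {v} {w} e = trans (sym (ε v)) (trans (cong r e) (ε w))

    conj-η : {v w : V} (e : v ≡ w) → conj (cong η e) ≡ e
    conj-η {v} refl = trans-symˡ (ε v)

    module _ (h : ○ X → V) where
      k : ○ X → V
      k = ○-rec m (λ x → h (η x))

      b : ∀ x → k (η x) ≡ h (η x)
      b = ○-rec-β m (λ x → h (η x))

      H : ∀ z → k z ≡ h z
      H z = conj (○-htpy {u = λ z → η (k z)} {v = λ z → η (h z)}
                    (λ x → cong η (b x)) z)

      H-η : ∀ x → H (η x) ≡ b x
      H-η x = trans (cong conj (○-htpy-β (λ x → cong η (b x)) x))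
                    (conj-η (b x))

    ψ⁻¹ψ : ∀ h → ψ⁻¹ (ψ {X , s} {V , t} h) ≡ h
    ψ⁻¹ψ (h , h₀) = hom-path {proj₁ (○A-ob (X , s))} {V , t} (H h)
      (λ a → trans (cong (λ e → trans (sym e) (trans (b h (s a)) (h₀ a)))
                         (H-η h (s a)))
                   (cancel (b h (s a)) (h₀ a)))

  adjunction : WildAdjunction ○A 𝓕
  adjunction = record
    { ψ         = λ {U} {V} → ψ {U} {proj₁ V}
    ; ψ-isEquiv = λ {U} {V} → ψ-equiv {U} {proj₁ V} (proj₂ V)
    ; nat-cod   = λ _ _ → refl
    ; nat-dom   = λ {U} {U′} {V} → ψ-nat-dom {U} {U′} {proj₁ V}
    }

{-# OPTIONS --without-K #-}

-- Every path in the coherence equation is built by functoriality from paths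
-- hom-path H C, so both sides have the form hom-path H C, and such paths agree
-- as soon as their homotopies agree compatibly with the data over A.  The
-- homotopy of ○_∘ at η x is known from the computation rule of ○-induction;
-- with it the two homotopies and their compatibilities become expressions in
-- the paths β_f, β_g, β_{g ∘ f} and the structure maps of A at one point, and
-- are compared by path induction on those.
module Submission where

open import Level using (Level)
open import Data.Product.Base using (Σ-syntax; _,_; proj₁; proj₂)
open import Relation.Binary.PropositionalEquality
  using (_≡_; refl; sym; trans; cong; cong-app; subst)
open import Relation.Binary.PropositionalEquality.Properties
  using (trans-reflʳ)
open import Defs

-- Fibres of bi-invertible maps.

-- The fibre of f over y is a retract of Σ[ y′ ∈ Y ] (y′ ≡ y), by way of
-- Σ[ y′ ∈ Y ] (f (section y′) ≡ y); so no half-adjoint coherence is needed.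
module _ {a b} {X : Set a} {Y : Set b} {f : X → Y} (eqv : IsEquiv f) where
  private
    g : Y → X
    g = proj₁ (proj₁ eqv)

    fg : ∀ y → f (g y) ≡ y
    fg = proj₂ (proj₁ eqv)

    -- The retraction applied to `fg (f x)` shows that the section inverts `f` on the left too.
    gf : ∀ x → g (f x) ≡ x
    gf x = trans (sym (hf (g (f x))))
                 (trans (cong (proj₁ (proj₂ eqv)) (fg (f x))) (hf x))
      where hf = proj₂ (proj₂ eqv)

  fibre-contr : ∀ {x y} (q : f x ≡ y) →
                _≡_ {A = Σ[ x ∈ X ] (f x ≡ y)} (g y , fg y) (x , q)
  fibre-contr {x} {y} q =
    -- The path from `f x` to `y` used here is not `q`: it is chosen so that `fg (f x)` cancels and
    -- leaves `q′`, which `slide` carries to `q`.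
    trans (sym (shift (trans (sym (fg (f x))) q′)))
      (trans (cong (g (f x) ,_) (cancel (fg (f x)) q′))
             (slide (gf x)))
    where
    q′ : f (g (f x)) ≡ y
    q′ = trans (cong f (gf x)) q

    shift : ∀ {y′} (p : y′ ≡ y) →
            _≡_ {A = Σ[ x ∈ X ] (f x ≡ y)}
                (g y′ , trans (fg y′) p) (g y , fg y)
    shift refl = cong (g y ,_) (trans-reflʳ (fg y))

    cancel : ∀ {u v w : Y} (r : u ≡ v) (p : u ≡ w) →
             trans r (trans (sym r) p) ≡ p
    cancel refl p = refl

    slide : ∀ {x′} (r : x′ ≡ x) →
            _≡_ {A = Σ[ x ∈ X ] (f x ≡ y)} (x′ , trans (cong f r) q) (x , q)
    slide refl = refl

-- Paths between maps under `A`.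

module CosliceProperties {ℓ} (fe : FunExt ℓ ℓ) (A : Set ℓ) where
  open Coslice fe A

  htpy-ind : ∀ {p} {X : Set ℓ} {Y : X → Set ℓ} {f : ∀ x → Y x}
    (P : ∀ g → (∀ x → f x ≡ g x) → Set p) → P f (λ _ → refl) →
    ∀ {g} H → P g H
  htpy-ind {f = f} P d {g} H = subst (P g) (happly-ext H) (along (ext H))
    where
    along : ∀ {g} (e : f ≡ g) → P g (cong-app e)
    along refl = d

  -- The pairs (`ext`, `happly-ext`) and (`refl`, `refl`) lie in the same contractible fibre of
  -- `cong-app`.
  ext-refl : {X : Set ℓ} {Y : X → Set ℓ} {f : ∀ x → Y x} →
             ext {f = f} (λ _ → refl) ≡ refl
  ext-refl {f = f} = cong proj₁ (fibre-contr (fe f f) refl)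

  trans-compat : ∀ {B : Set ℓ} {k k′ k″ t : B} (h : k ≡ k′) (h′ : k′ ≡ k″)
    {p : k ≡ t} {p′ : k′ ≡ t} {p″ : k″ ≡ t} →
    trans (sym h) p ≡ p′ → trans (sym h′) p′ ≡ p″ →
    trans (sym (trans h h′)) p ≡ p″
  trans-compat refl refl c c′ = trans c c′

  sym-compat : ∀ {B : Set ℓ} {k k′ t : B} (h : k ≡ k′)
    {p : k ≡ t} {p′ : k′ ≡ t} →
    trans (sym h) p ≡ p′ → trans (sym (sym h)) p′ ≡ p
  sym-compat refl c = sym c

  module _ {X Y : Ob} where

    Compat : (f g : X →A Y) → (∀ x → proj₁ f x ≡ proj₁ g x) → Set ℓ
    Compat f g H =
      ∀ a → trans (sym (H (proj₂ X a))) (proj₂ f a) ≡ proj₂ g a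

    -- Once `H` is constant, `C` is a homotopy between the structure paths, and a second homotopy
    -- induction contracts it.
    hom-ind : ∀ {p} {f : X →A Y}
      (P : ∀ g (H : ∀ x → proj₁ f x ≡ proj₁ g x) → Compat f g H → Set p) →
      P f (λ _ → refl) (λ _ → refl) → ∀ {g} H C → P g H C
    hom-ind {f = k , p} P d H = htpy-ind
      (λ k′ H → ∀ {p′} (C : Compat (k , p) (k′ , p′) H) → P (k′ , p′) H C)
      (λ {p′} C → htpy-ind (λ p′ C → P (k , p′) (λ _ → refl) C) d C)
      H

    -- `hom-path` also involves `happly-ext`, so `ext` and `happly-ext` are replaced together, as a
    -- point of a fibre. The path left over comes from `ext` in `A`.
    hom-path-refl : {f : X →A Y} →
      hom-path {X} {Y} {f} {f} (λ _ → refl) (λ _ → refl) ≡ refl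
    hom-path-refl {f = k , p} = trans
      (cong (λ E → hom-path′ {X} {Y} {k , p} {k , p} (proj₁ E)
               (λ a → trans (cong (λ H → trans (sym (H (proj₂ X a))) (p a))
                                  (proj₂ E))
                            refl))
            (fibre-contr (fe k k) refl))
      (cong (cong (k ,_)) ext-refl)

    infix 4 _presented-by_,_
    _presented-by_,_ : {f g : X →A Y} → f ≡ g →
      (H : ∀ x → proj₁ f x ≡ proj₁ g x) → Compat f g H → Set ℓ
    _presented-by_,_ {f} {g} e H C = e ≡ hom-path {X} {Y} {f} {g} H C

    -- The second path is contracted first: its endpoint `h` is free, while `g` becomes free only
    -- after that.
    trans-presented : {f g h : X →A Y} {e : f ≡ g} {e′ : g ≡ h}
      {H : ∀ x → proj₁ f x ≡ proj₁ g x} {C : Compat f g H}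
      {H′ : ∀ x → proj₁ g x ≡ proj₁ h x} {C′ : Compat g h H′} →
      e presented-by H , C → e′ presented-by H′ , C′ →
      trans e e′ presented-by
        (λ x → trans (H x) (H′ x)) ,
        (λ a → trans-compat (H (proj₂ X a)) (H′ (proj₂ X a)) (C a) (C′ a))
    trans-presented {f} {g} {h} {H = H} {C} {H′} {C′} refl refl =
      hom-ind {f = g}
        (λ h H′ C′ →
          trans (hom-path {X} {Y} {f} {g} H C)
                (hom-path {X} {Y} {g} {h} H′ C′) presented-by
          (λ x → trans (H x) (H′ x)) ,
          (λ a → trans-compat (H (proj₂ X a)) (H′ (proj₂ X a)) (C a) (C′ a)))
        (hom-ind {f = f}
          (λ g H C →
            trans (hom-path {X} {Y} {f} {g} H C)
                  (hom-path {X} {Y} {g} {g} (λ _ → refl) (λ _ → refl))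
            presented-by
            (λ x → trans (H x) refl) ,
            (λ a → trans-compat (H (proj₂ X a)) refl (C a) refl))
          (cong (λ e → trans e (hom-path {X} {Y} {f} {f}
                                  (λ _ → refl) (λ _ → refl)))
                hom-path-refl)
          H C)
        H′ C′

    sym-presented : {f g : X →A Y} {e : f ≡ g}
      {H : ∀ x → proj₁ f x ≡ proj₁ g x} {C : Compat f g H} →
      e presented-by H , C →
      sym e presented-by
        (λ x → sym (H x)) , (λ a → sym-compat (H (proj₂ X a)) (C a))
    sym-presented {f} {H = H} {C} refl = hom-ind {f = f}
      (λ g H C → sym (hom-path {X} {Y} {f} {g} H C) presented-by
                   (λ x → sym (H x)) ,
                   (λ a → sym-compat (H (proj₂ X a)) (C a)))
      (trans (cong sym hom-path-refl) (sym hom-path-refl))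
      H C

    -- The second premise says that `C` is `C′` transported back along `K`; for constant `K` it is a
    -- homotopy from `C` to `C′`.
    hom-path-cong : {f g : X →A Y}
      {H H′ : ∀ x → proj₁ f x ≡ proj₁ g x}
      {C : Compat f g H} {C′ : Compat f g H′} →
      (K : ∀ x → H x ≡ H′ x) →
      (∀ a → C a ≡ trans (cong (λ h → trans (sym h) (proj₂ f a))
                               (K (proj₂ X a)))
                         (C′ a)) →
      hom-path {X} {Y} {f} {g} H C ≡ hom-path {X} {Y} {f} {g} H′ C′
    hom-path-cong {f} {g} {H} {C = C} {C′} K D = htpy-ind {f = H}
      (λ H′ K → ∀ {C′ : Compat f g H′} →
        (∀ a → C a ≡ trans (cong (λ h → trans (sym h) (proj₂ f a))
                                 (K (proj₂ X a)))
                           (C′ a)) →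
        hom-path {X} {Y} {f} {g} H C ≡ hom-path {X} {Y} {f} {g} H′ C′)
      (λ D → cong (hom-path {X} {Y} {f} {g} H) (ext D))
      K D

  postcomp-compat : ∀ {B B′ : Set ℓ} (m : B → B′) {k k′ t : B} {t′ : B′}
    (q : m t ≡ t′) (h : k ≡ k′) {p : k ≡ t} {p′ : k′ ≡ t} →
    trans (sym h) p ≡ p′ →
    trans (sym (cong m h)) (trans (cong m p) q) ≡ trans (cong m p′) q
  postcomp-compat m q refl c = cong (λ r → trans (cong m r) q) c

  postcomp-presented : ∀ {X Y Z} (m : Y →A Z) {f g : X →A Y} {e : f ≡ g}
    {H : ∀ x → proj₁ f x ≡ proj₁ g x} {C : Compat {X} {Y} f g H} →
    _presented-by_,_ {X} {Y} e H C →
    _presented-by_,_ {X} {Z} (cong (comp {X} {Y} {Z} m) e)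
      (λ x → cong (proj₁ m) (H x))
      (λ a → postcomp-compat (proj₁ m) (proj₂ m a) (H (proj₂ X a)) (C a))
  postcomp-presented {X} {Y} {Z} m {f} {H = H} {C} refl =
    hom-ind {X} {Y} {f = f}
      (λ g H C → _presented-by_,_ {X} {Z}
        (cong (comp {X} {Y} {Z} m) (hom-path {X} {Y} {f} {g} H C))
        (λ x → cong (proj₁ m) (H x))
        (λ a → postcomp-compat (proj₁ m) (proj₂ m a) (H (proj₂ X a)) (C a)))
      (trans (cong (cong (comp {X} {Y} {Z} m)) (hom-path-refl {X} {Y}))
             (sym (hom-path-refl {X} {Z})))
      H C

  precomp-compat : ∀ {B B′ : Set ℓ} {k k′ : B → B′} (H : ∀ b → k b ≡ k′ b)
    {b b′ : B} {t : B′} (r : b ≡ b′) {p : k b′ ≡ t} {p′ : k′ b′ ≡ t} →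
    trans (sym (H b′)) p ≡ p′ →
    trans (sym (H b)) (trans (cong k r) p) ≡ trans (cong k′ r) p′
  precomp-compat H refl c = c

  precomp-presented : ∀ {W X Y} (m : W →A X) {f g : X →A Y} {e : f ≡ g}
    {H : ∀ x → proj₁ f x ≡ proj₁ g x} {C : Compat {X} {Y} f g H} →
    _presented-by_,_ {X} {Y} e H C →
    _presented-by_,_ {W} {Y} (cong (λ f → comp {W} {X} {Y} f m) e)
      (λ w → H (proj₁ m w))
      (λ a → precomp-compat H (proj₂ m a) (C a))
  precomp-presented {W} {X} {Y} m {f} {H = H} {C} refl =
    hom-ind {X} {Y} {f = f}
      (λ g H C → _presented-by_,_ {W} {Y}
        (cong (λ f → comp {W} {X} {Y} f m) (hom-path {X} {Y} {f} {g} H C))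
        (λ w → H (proj₁ m w))
        (λ a → precomp-compat H (proj₂ m a) (C a)))
      (trans (cong (cong (λ f → comp {W} {X} {Y} f m)) (hom-path-refl {X} {Y}))
             (trans (sym (hom-path-refl {W} {Y}))
                    -- Unlike `postcomp-compat`, `precomp-compat` is stuck on the structure path of
                    -- `m` even at `refl`, so that path is contracted pointwise.
                    (cong (hom-path {W} {Y} (λ _ → refl))
                          (ext (λ a → refl-compat (proj₂ m a))))))
      H C
    where
    refl-compat : ∀ {B B′ : Set ℓ} {k : B → B′} {b b′ : B} (r : b ≡ b′)
      {t : B′} {p : k b′ ≡ t} →
      refl ≡ precomp-compat {k = k} (λ _ → refl) r {p} refl
    refl-compat refl = refl

-- Coherence of the modal adjunction.

module ModalCosliceProperties
  {ℓ} (fe : FunExt ℓ ℓ) (M : Modality ℓ) (A : Set ℓ) where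
  open Modality M
  open Coslice fe A
  open CosliceProperties fe A
  open ModalCoslice fe M A

  -- `C` is unchanged because the structure map of `○A-ob U` is that of `U` followed by `η`.
  ψ-presented : ∀ {U V} {f g : proj₁ (○A-ob U) →A V} {e : f ≡ g}
    {H : ∀ x → proj₁ f x ≡ proj₁ g x}
    {C : Compat {proj₁ (○A-ob U)} {V} f g H} →
    _presented-by_,_ {proj₁ (○A-ob U)} {V} e H C →
    _presented-by_,_ {U} {V} (cong (ψ {U} {V}) e) (λ x → H (η x)) C
  ψ-presented {U} {V} {f} {H = H} {C} refl =
    hom-ind {proj₁ (○A-ob U)} {V} {f = f}
      (λ g H C → _presented-by_,_ {U} {V}
        (cong (ψ {U} {V}) (hom-path {proj₁ (○A-ob U)} {V} {f} {g} H C))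
        (λ x → H (η x)) C)
      (trans (cong (cong (ψ {U} {V})) (hom-path-refl {proj₁ (○A-ob U)} {V}))
             (sym (hom-path-refl {U} {V})))
      H C

  sym-cong-reflʳ : ∀ {B V : Set ℓ} (k : B → V) {w x : B} (b : w ≡ x) →
    sym (cong k (trans b refl)) ≡ trans (trans (sym (cong k b)) refl) refl
  sym-cong-reflʳ k refl = refl

  -- Instantiated with k underlying h₁, G = ○f₂, bf = β_{f₃}, bg = β_{f₂} and
  -- bgf = β_{f₂ ∘ f₃}.  No induction on bg here: compat-coherence abstracts G z
  -- and must see the result depend on bg only.
  htpy-coherence : ∀ {B B′ V : Set ℓ} (k : B′ → V) (G : B → B′)
    {u z : B} {v x : B′} (bf : u ≡ z) (bg : G z ≡ x) (bgf : v ≡ x)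
    {K : G u ≡ v} (ρ : K ≡ trans (trans (cong G bf) bg) (sym bgf)) →
    trans (trans refl (sym (cong k bgf))) (sym (cong k K)) ≡
    trans (trans (sym (cong k bg)) (sym (cong (λ z → k (G z)) bf))) refl
  htpy-coherence k G refl bg refl refl = sym-cong-reflʳ k bg

  -- This is the second premise of `hom-path-cong` at one point of `A`, with the endpoints of all
  -- paths but those from `β g` made free.
  compat-coherence : ∀ {X Z V : Set ℓ} (k : ○ X → V) (g : Z → X)
    {u : ○ Z} {v : ○ X} {z z′ : Z} {x : X} {t : V}
    (bf : u ≡ η z) (bgf : v ≡ η (g z))
    (r : z ≡ z′) (q : g z′ ≡ x) (h₀ : k (η x) ≡ t) {K : ○-map g u ≡ v}
    (ρ : K ≡ trans (trans (cong (○-map g) bf) (β g z)) (sym bgf)) →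
    trans-compat (trans refl (sym (cong k bgf))) (sym (cong k K))
      (trans-compat refl (sym (cong k bgf))
        (assoc-compat (λ x → k (η x)) g r q h₀)
        (nat-dom-compat k bgf (trans (cong g r) q) h₀))
      (sym-compat (cong k K)
        (postcomp-compat k h₀ K (○A-∘-compat g bf bgf r q ρ)))
    ≡
    trans
      (cong (λ h → trans (sym h) (trans (cong (λ x → k (η (g x))) r)
                                        (trans (cong (λ x → k (η x)) q) h₀)))
            (htpy-coherence k (○-map g) bf (β g z) bgf ρ))
      (trans-compat
        (trans (sym (cong k (β g z))) (sym (cong (λ y → k (○-map g y)) bf)))
        refl
        (trans-compat (sym (cong k (β g z)))
                      (sym (cong (λ y → k (○-map g y)) bf))
          (precomp-compat (λ x → sym (cong k (β g x))) r
            (nat-dom-compat k (β g z′) q h₀))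
          (nat-dom-compat (λ y → k (○-map g y)) bf r
            (trans (cong k (trans (β g z′) (cong η q))) h₀)))
        (assoc-compat k (○-map g) (trans bf (cong η r))
                      (trans (β g z′) (cong η q)) h₀))
  compat-coherence k g {z = z} refl refl refl refl refl refl
    -- Neither endpoint of `β g z` is a variable; abstracting `○-map g (η z)` frees one.
    with ○-map g (η z) | β g z
  ... | _ | refl = refl

  two-coherent : TwoCoherent adjunction
  two-coherent {X} {Z} {W , s} {V} (k , h₀) (f₂ , q) (f₃ , r) = trans
    (trans-presented {W , s} {proj₁ V}
      -- Associators, `nat-dom` and the composition law are `hom-path`s by definition, hence
      -- presented by `refl`.
      (trans-presented {W , s} {proj₁ V} refl refl)
      (sym-presented {W , s} {proj₁ V} (ψ-presented {W , s} {proj₁ V}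
        (postcomp-presented {proj₁ (○A-ob (W , s))} {proj₁ (○A-ob X)} {proj₁ V}
          (k , h₀) refl))))
    (trans
      (hom-path-cong {W , s} {proj₁ V}
        -- `ψ` evaluates the homotopy of the composition law only at `η w`, where `○-htpy-β`
        -- computes it. At `s a` this is the same `ρ` that built the compatibility in `○A`.
        (λ w → htpy-coherence k (○-map f₂) (β f₃ w) (β f₂ (f₃ w))
                 (β (λ x → f₂ (f₃ x)) w) (○-htpy-β _ w))
        (λ a → compat-coherence k f₂ (β f₃ (s a)) (β (λ x → f₂ (f₃ x)) (s a))
                 (r a) (q a) (h₀ a) (○-htpy-β _ (s a))))
      (sym (trans-presented {W , s} {proj₁ V}
        (trans-presented {W , s} {proj₁ V}
          (precomp-presented {W , s} {Z} {proj₁ V} (f₃ , r) refl)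
          refl)
        (ψ-presented {W , s} {proj₁ V} refl))))

theorem7p2 : ∀ {ℓ : Level} (fe : FunExt ℓ ℓ) (M : Modality ℓ) (A : Set ℓ) →
    TwoCoherent (ModalCoslice.adjunction fe M A)
theorem7p2 = ModalCosliceProperties.two-coherent
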